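{- Let $T$ be an $n+n$ symbic tree, and let $O$ be a chosen vertex of $T$ fixed by the color-swapping involution. For each node $v$ of $T$ (nodes being taken up to the involution), let $P_v$ be the configuration of points $\mathbf e_i+\mathbf e_j\in\mathbb{Z}^n$ such that the path from $O$ to leaf $i$ and the path from $O$ to leaf $j'$ diverge at the node $v$. Then the matroid associated with $T$ is given by the affine independences in the Cayley embedding of the configurations $P_v$: a set $S\subseteq\{(i,j):1\le i\le j\le n\}$ is independent in the matroid of $T$ if and only if the corresponding points of the Cayley embedding are affinely independent, where $(i,j)$ corresponds to the copy of $\mathbf e_i+\mathbf e_j$ in $P_v$ for the unique $v$ (up to the involution) with $\mathbf e_i+\mathbf e_j\in P_v$.
   Context: **Symbic trees.** A split of a tree is a partition of the leaf labels obtained by removing an internal (non-leaf) edge. An $n+n$ symbic tree is a metric tree on leaves labelled $1,\dots,n,1',\dots,n'$ (unprimed and primed labels are two colors; no unlabelled vertices of degree 2; lengths of leaf edges disregarded) such that (1) each split contains both colors on both sides; (2) internal edges have positive lengths; (3) the metric tree is symmetric with respect to the involution swapping $i$ and $i'$ for all $i$; (4) the fixed points of the involution form a path (possibly a single point; if it is the midpoint of an edge, it is regarded as a vertex of degree 2). Nodes are the non-leaf vertices. Two nodes exchanged by the involution are identified (they carry the same parameter, the distance from $O$). **Matroid of $T$.** Let $\mathcal T$ be the combinatorial type of $T$ (forgetting lengths) and let $C_{\mathcal T}$ be the cone of symmetric real $n\times n$ matrices of symmetric tropical rank $2$ whose symbic tree has type $\mathcal T$. Explicitly, $C_{\mathcal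 T}=\{A_{T'}\mid T'\text{ a symbic tree of type }\mathcal T\}+L$, where $L=\{(X_i+X_j)_{i,j}\mid X\in\mathbb{R}^n\}$ and $A_{T'}$ is the symmetric matrix whose $(i,j)$ entry is the distance in $T'$ from $O$ to the vertex where the path from $O$ to leaf $i$ and the path from $O$ to leaf $j'$ diverge. The matroid associated with $T$ is the matroid on $E=\{(i,j):1\le i\le j\le n\}$ in which $S$ is independent iff the projection of the linear span of $C_{\mathcal T}$ (in $\mathbb{R}^E$) to $\mathbb{R}^S$ is surjective. **Cayley embedding.** For point configurations $P_0,P_1,\dots,P_r\subset\mathbb{Z}^n$, the Cayley embedding is the configuration $(P_0\times\{0\})\cup(P_1\times\{\mathbf e_1\})\cup\dots\cup(P_r\times\{\mathbf e_r\})\subset\mathbb{Z}^n\times\mathbb{Z}^r$. Here $P_0=P_O$ is the configuration of the node $O$ and $P_1,\dots,P_r$ are those of the remaining nodes up to the involution. -}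

module Defs where

open import Level using (Level; 0ℓ; _⊔_) renaming (suc to lsuc)
open import Algebra.Bundles using (CommutativeRing)
import Algebra.Definitions.RawMonoid as RawMonoidMult
import Algebra.Properties.Semiring.Sum as SemiringSum
open import Data.Bool.Base using (Bool; T; if_then_else_)
open import Data.Fin.Base as Fin using (Fin; zero; suc)
open import Data.Fin.Properties using (_≟_)
open import Data.Integer.Base as ℤ using (ℤ; +_; -[1+_]; 0ℤ; 1ℤ)
open import Data.List.Base using (List; []; _∷_; length)
open import Data.List.Membership.Propositional using (_∈_)
open import Data.List.Relation.Unary.Unique.Propositional using (Unique)
open import Data.Nat.Base as ℕ using (ℕ; zero; suc)
open import Data.Product.Base using (Σ; Σ-syntax; ∃; ∃₂; ∃-syntax; _×_; _,_; proj₁; proj₂)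
open import Data.Sum.Base using (_⊎_)
open import Data.Vec.Functional using (Vector; _++_)
open import Function.Base using (_∘_)
open import Function.Bundles using (_⇔_)
open import Function.Definitions using (Injective; StrictlySurjective)
open import Relation.Binary.Construct.Closure.ReflexiveTransitive using (Star; ε; _◅_)
open import Relation.Binary.Core using (Rel)
open import Relation.Binary.Definitions using (Symmetric; Irreflexive)
open import Relation.Binary.PropositionalEquality using (_≡_; refl; _≗_)
open import Relation.Binary.Structures using (IsStrictTotalOrder)
open import Relation.Nullary.Decidable using (does)
open import Relation.Nullary.Negation using (¬_)
import Relation.Unary as Unary
open Unary using (Pred)

private
  variable
    c ℓ₁ ℓ₂ p : Level

------------------------------------------------------------------------
-- Scalars

-- The library has no real numbers.  Everything below that involves real
-- scalars is done over an arbitrary (totally) ordered field; ℝ is the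
-- intended instance.
record OrderedField c ℓ₁ ℓ₂ : Set (lsuc (c ⊔ ℓ₁ ⊔ ℓ₂)) where
  infix 4 _<_
  field
    commutativeRing    : CommutativeRing c ℓ₁
  open CommutativeRing commutativeRing public
  field
    _<_                : Rel Carrier ℓ₂
    isStrictTotalOrder : IsStrictTotalOrder _≈_ _<_
    0<1                : 0# < 1#
    +-monoˡ-<          : ∀ z {x y} → x < y → x + z < y + z
    *-pos              : ∀ {x y} → 0# < x → 0# < y → 0# < x * y
    inverse            : ∀ x → ¬ (x ≈ 0#) → ∃[ y ] x * y ≈ 1#

  open SemiringSum semiring public using (sum)

  fromℤ : ℤ → Carrier
  fromℤ (+ k)    = k ×ℕ 1#
    where open RawMonoidMult +-rawMonoid renaming (_×_ to _×ℕ_)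
  fromℤ -[1+ k ] = - (suc k ×ℕ 1#)
    where open RawMonoidMult +-rawMonoid renaming (_×_ to _×ℕ_)

------------------------------------------------------------------------
-- Graphs and trees

module Graph {V : Set} (Adj : Rel V 0ℓ) where

  Walk : Rel V 0ℓ
  Walk = Star Adj

  vertices : ∀ {u v} → Walk u v → List V
  vertices {u} ε       = u ∷ []
  vertices {u} (_ ◅ w) = u ∷ vertices w

  Path : Rel V 0ℓ
  Path u v = Σ[ w ∈ Walk u v ] Unique (vertices w)

  pathVertices : ∀ {u v} → Path u v → List V
  pathVertices = vertices ∘ proj₁

  -- A tree is a simple graph in which any two vertices are joined by
  -- exactly one path.
  record IsTree : Set where
    field
      adj-sym     : Symmetric Adj
      adj-irrefl  : Irreflexive _≡_ Adj
      path        : ∀ u v → Path u v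
      path-unique : ∀ {u v} (π ρ : Path u v) → pathVertices π ≡ pathVertices ρ

  Degree : V → ℕ → Set
  Degree v k = ∃[ xs ] Unique xs × length xs ≡ k × (∀ w → w ∈ xs ⇔ Adj v w)

  Delete : V → V → Rel V 0ℓ
  Delete u w x y = Adj x y × ¬ (x ≡ u × y ≡ w) × ¬ (x ≡ w × y ≡ u)

  -- x lies on the side of w after removing the edge {u , w}.
  OnSide : V → V → V → Set
  OnSide u w x = Star (Delete u w) w x

------------------------------------------------------------------------
-- Symbic trees

data Colour : Set where
  unprimed primed : Colour

opposite : Colour → Colour
opposite unprimed = primed
opposite primed   = unprimed

data Vertex (n m : ℕ) : Set where
  leaf : Colour → Fin n → Vertex n m
  node : Fin m → Vertex n m

swapColours : ∀ {n m} → (Fin m → Fin m) → Vertex n m → Vertex n m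
swapColours τ (leaf a i) = leaf (opposite a) i
swapColours τ (node v)   = node (τ v)

-- The combinatorial type of an n+n symbic tree.  If the involution flips an
-- edge, the midpoint of that edge is one of the nodes; it is the only node
-- allowed to have degree 2.  This subdivision does not change the set of
-- splits.
record SymbicType (n : ℕ) : Set₁ where
  field
    #nodes : ℕ

  Node : Set
  Node = Fin #nodes

  V : Set
  V = Vertex n #nodes

  field
    Adj    : Rel V 0ℓ
    isTree : Graph.IsTree Adj
    τ      : Node → Node

  open Graph Adj public
  open IsTree isTree public

  σ : V → V
  σ = swapColours τ

  IsMidpoint : Node → Set
  IsMidpoint v = Degree (node v) 2 × (∀ w → σ w ≡ w ⇔ w ≡ node v)

  field
    leaf-degree  : ∀ a i → Degree (leaf a i) 1
    node-degree  : ∀ v → (∃[ k ] 3 ℕ.≤ k × Degree (node v) k) ⊎ IsMidpoint v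
    -- Every internal edge occurs here in both orientations, so both of its
    -- sides are covered.
    split-colour : ∀ {u w} → Adj (node u) (node w) →
                   ∀ a → ∃[ i ] OnSide (node u) (node w) (leaf a i)
    τ-involutive : ∀ v → τ (τ v) ≡ v
    σ-adj        : ∀ {x y} → Adj x y → Adj (σ x) (σ y)
    fixed-path   : ∃₂ λ u v → Σ[ π ∈ Path u v ] (∀ w → σ w ≡ w ⇔ w ∈ pathVertices π)

  -- The last common node of two walks, given by their vertices, when d is
  -- the last common node found so far.  Paths with a common starting node
  -- to two different leaves share no leaf, so for them this is the vertex
  -- where they diverge.
  lastCommonNode : Node → List V → List V → Node
  lastCommonNode d (node x ∷ xs) (node y ∷ ys) =
    if does (x ≟ y) then lastCommonNode x xs ys else d
  lastCommonNode d _ _ = d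

  -- The node where the paths from O to leaf i and to leaf j′ diverge.
  divergence : Node → Fin n → Fin n → Node
  divergence O i j = lastCommonNode O
    (pathVertices (path (node O) (leaf unprimed i)))
    (pathVertices (path (node O) (leaf primed j)))

-- Lengths of the internal edges, i.e. of the edges between two nodes; the
-- value of length at a non-adjacent pair of nodes is irrelevant.
record Metric (K : OrderedField c ℓ₁ ℓ₂) {n} (𝒯 : SymbicType n) : Set (c ⊔ ℓ₁ ⊔ ℓ₂) where
  open OrderedField K using (Carrier; _≈_; _<_; _+_; 0#)
  open SymbicType 𝒯
  field
    len     : Node → Node → Carrier
    len-sym : ∀ {u w} → Adj (node u) (node w) → len u w ≈ len w u
    len-pos : ∀ {u w} → Adj (node u) (node w) → 0# < len u w
    len-τ   : ∀ {u w} → Adj (node u) (node w) → len (τ u) (τ w) ≈ len u w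

  -- Leaf edges do not contribute.
  edgeLength : V → V → Carrier
  edgeLength (node u) (node w) = len u w
  edgeLength _        _        = 0#

  pathLength : List V → Carrier
  pathLength (x ∷ y ∷ xs) = edgeLength x y + pathLength (y ∷ xs)
  pathLength _            = 0#

  dist : Node → Node → Carrier
  dist u v = pathLength (pathVertices (path (node u) (node v)))

record SymbicTree (K : OrderedField c ℓ₁ ℓ₂) (n : ℕ) : Set (lsuc 0ℓ ⊔ c ⊔ ℓ₁ ⊔ ℓ₂) where
  field
    type   : SymbicType n
    metric : Metric K type
  open SymbicType type public
  open Metric metric public

------------------------------------------------------------------------
-- The ground set

E : ℕ → Set
E n = Σ[ (i , j) ∈ Fin n × Fin n ] i Fin.≤ j

Subset : Set → Set
Subset A = A → Bool

-- The elements of a subset, as a type.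
↥ : {A : Set} → Subset A → Set
↥ {A} S = Σ[ a ∈ A ] T (S a)

------------------------------------------------------------------------
-- Linear algebra, and the matroid of a symbic tree

module _ (K : OrderedField c ℓ₁ ℓ₂) where
  open OrderedField K using (Carrier; _≈_; _+_; _*_; 0#; sum; fromℤ)

  Span : {I : Set} → Pred (I → Carrier) p → Pred (I → Carrier) (c ⊔ ℓ₁ ⊔ p)
  Span C M = ∃[ k ] Σ[ a ∈ Vector Carrier k ] Σ[ G ∈ Vector _ k ]
    (∀ l → C (G l)) × (∀ x → M x ≈ sum (λ l → a l * G l x))

  -- Affine independence over K of a family of integer points: an affine
  -- relation among finitely many members with distinct indices is trivial.
  AffinelyIndependent : {I : Set} {d : ℕ} → (I → Vector ℤ d) → Set (c ⊔ ℓ₁)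
  AffinelyIndependent {I} {d} point =
    ∀ k (s : Vector I k) → Injective _≡_ _≡_ s → (a : Vector Carrier k) →
    sum a ≈ 0# →
    (∀ (x : Fin d) → sum (λ l → a l * fromℤ (point (s l) x)) ≈ 0#) →
    ∀ l → a l ≈ 0#

  Matrix : ℕ → Set c
  Matrix n = Fin n × Fin n → Carrier

  module _ {n : ℕ} (𝒯 : SymbicType n) (O : SymbicType.Node 𝒯) where
    open SymbicType 𝒯 using (divergence)

    distanceMatrix : Metric K 𝒯 → Matrix n
    distanceMatrix μ (i , j) = Metric.dist μ O (divergence O i j)

    Cone : Pred (Matrix n) (c ⊔ ℓ₁ ⊔ ℓ₂)
    Cone M = Σ[ μ ∈ Metric K 𝒯 ] Σ[ X ∈ Vector Carrier n ]
      (∀ i j → M (i , j) ≈ distanceMatrix μ (i , j) + (X i + X j))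

  -- The matrices in the cone are symmetric; the upper triangular entries
  -- embed them in Kᴱ.
  Independent : ∀ {n} (T : SymbicTree K n) → SymbicTree.Node T → Subset (E n) →
                Set (c ⊔ ℓ₁ ⊔ ℓ₂)
  Independent T O S =
    (y : ↥ S → Carrier) →
    ∃[ M ] Span (Cone (SymbicTree.type T) O) M × (∀ (e : ↥ S) → M (proj₁ (proj₁ e)) ≈ y e)

------------------------------------------------------------------------
-- Point configurations and the Cayley embedding

Configuration : ℕ → Set₁
Configuration n = Pred (Vector ℤ n) 0ℓ

unit : ∀ {n} → Fin n → Vector ℤ n
unit i j = if does (i ≟ j) then 1ℤ else 0ℤ

infixl 6 _⊕_
_⊕_ : ∀ {n} → Vector ℤ n → Vector ℤ n → Vector ℤ n
(x ⊕ y) i = x i ℤ.+ y i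

module _ {n r : ℕ} (P : Fin (suc r) → Configuration n) where

  -- The disjoint union of P₀, …, P_r.
  Copies : Set
  Copies = ∃₂ λ k x → P k x

  apex : Fin (suc r) → Vector ℤ r
  apex zero    = λ _ → 0ℤ
  apex (suc k) = unit k

  cayley : Copies → Vector ℤ (n ℕ.+ r)
  cayley (k , x , _) = x ++ apex k

-- A numbering 0, …, r of the nodes up to the involution, with O numbered 0.
record Numbering {n} (𝒯 : SymbicType n) (O : SymbicType.Node 𝒯) : Set where
  open SymbicType 𝒯
  field
    r          : ℕ
    class      : Node → Fin (suc r)
    class-O    : class O ≡ zero
    class-≡    : ∀ u v → class u ≡ class v ⇔ (u ≡ v ⊎ u ≡ τ v)
    surjective : StrictlySurjective _≡_ class

module _ {n} (𝒯 : SymbicType n) (O : SymbicType.Node 𝒯) (N : Numbering 𝒯 O) where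
  open SymbicType 𝒯 using (divergence)
  open Numbering N

  -- P_v for the nodes v numbered k.
  nodeConfiguration : Fin (suc r) → Configuration n
  nodeConfiguration k x =
    ∃₂ λ i j → class (divergence O i j) ≡ k × x ≗ unit i ⊕ unit j

  -- The copy of e_i + e_j that corresponds to (i , j).  The involution
  -- exchanges the divergence nodes of (i , j′) and (j , i′), so no other
  -- member of the family contains e_i + e_j.
  copy : E n → Copies nodeConfiguration
  copy ((i , j) , _) =
    class (divergence O i j) , unit i ⊕ unit j , i , j , refl , λ _ → refl

  cayleyPoint : E n → Vector ℤ (n ℕ.+ r)
  cayleyPoint e = cayley nodeConfiguration (copy e)

-- For weights w on the coordinates, the values of w at the Cayley points form
-- the matrix w(class of the divergence node) + wᵢ + wⱼ, with weight 0 for the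
-- class of O.  The linear span of the cone consists of exactly these matrices:
-- the distance from O is invariant under the involution and vanishes at O, and
-- conversely every invariant function of the nodes vanishing at O is a
-- difference of distance functions.  So S is independent in the matroid iff the
-- linear system prescribing the weighted values at the points of S is always
-- solvable, i.e. iff these points are linearly independent.  A linear relation
-- among them is affine, because the first n coordinates of each point sum to 2.
module Submission where

open import Defs
open import Data.Nat.Base using (ℕ)
open import Data.Product.Base using (proj₁)
open import Function.Bundles using (_⇔_)
open import Relation.Binary.PropositionalEquality using (_≡_)

import Algebra.Properties.Monoid.Mult as MonoidMult
import Algebra.Properties.Ring as RingProperties
import Algebra.Properties.Semiring.Sum as SemiringSum
import Algebra.Solver.Ring.NaturalCoefficients.Default as SemiringSolver
open import Data.Bool.Base using (true; false; T; if_then_else_)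
open import Data.Bool.Properties using (T?; T-irrelevant)
open import Data.Fin.Base as Fin using (Fin; zero; suc; _↑ˡ_; _↑ʳ_)
import Data.Fin.Properties as Fin
open import Data.Integer.Base using (0ℤ; 1ℤ)
open import Data.List.Base as List
  using (List; []; _∷_; _++_; [_]; allFin; cartesianProduct; filter; length; map)
open import Data.List.Membership.Propositional using (_∈_; _∉_)
open import Data.List.Membership.Propositional.Properties
  using (∈-++⁺ʳ; ∈-allFin; ∈-cartesianProduct⁺; ∈-filter⁺; ∈-filter⁻; ∈-lookup)
open import Data.List.Properties using (++-assoc; length-++; length-map)
open import Data.List.Relation.Unary.All as All using ()
open import Data.List.Relation.Unary.All.Properties using (++⁻ˡ)
open import Data.List.Relation.Unary.AllPairs using ([]; _∷_)
open import Data.List.Relation.Unary.Any as Any using (here; there)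
open import Data.List.Relation.Unary.Any.Properties using (lookup-index)
open import Data.List.Relation.Unary.Unique.Propositional using (Unique)
import Data.List.Relation.Unary.Unique.Propositional.Properties as Unique
open import Data.Nat.Base as ℕ using (zero; suc)
import Data.Nat.Properties as ℕ
open import Data.Product.Base using (Σ-syntax; ∃-syntax; _×_; _,_; proj₂)
open import Data.Product.Properties using (≡-dec)
open import Data.Sum.Base using (_⊎_; inj₁; inj₂)
open import Data.Vec.Functional as Vec using (Vector)
open import Data.Vec.Functional.Properties using (lookup-++ˡ; lookup-++ʳ)
open import Function.Base using (_∘_)
open import Function.Bundles using (Equivalence; mk⇔)
open import Function.Definitions using (Injective)
open import Level using (0ℓ)
open import Relation.Binary.Construct.Closure.ReflexiveTransitive using (ε; _◅_; _◅◅_; gmap)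
open import Relation.Binary.Construct.Closure.ReflexiveTransitive.Properties using (◅◅-assoc)
open import Relation.Binary.Core using (Rel)
open import Relation.Binary.Definitions using (DecidableEquality; tri<; tri≈; tri>)
open import Relation.Binary.PropositionalEquality as ≡ using (cong; subst; subst₂)
import Relation.Binary.Reasoning.Setoid as SetoidReasoning
open import Relation.Binary.Structures using (IsStrictTotalOrder)
open import Relation.Nullary.Decidable
  using (Dec; yes; no; does; map′; ¬?; dec-true; dec-false; decidable-stable)
open import Relation.Nullary.Negation using (¬_; contradiction)

-- Arithmetic and order in an ordered field.

module OrderedFieldProperties {c ℓ₁ ℓ₂} (K : OrderedField c ℓ₁ ℓ₂) where
  open OrderedField K hiding (zero)
  open IsStrictTotalOrder isStrictTotalOrder public
    using (compare; <-respʳ-≈; <-respˡ-≈) renaming (_≟_ to _≈?_; trans to <-trans; irrefl to <-irrefl)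
  open SemiringSolver commutativeSemiring using (solve; _:+_; _:=_)
  open SetoidReasoning setoid

  +-monoʳ-< : ∀ z {x y} → x < y → z + x < z + y
  +-monoʳ-< z x<y = <-respˡ-≈ (+-comm _ z) (<-respʳ-≈ (+-comm _ z) (+-monoˡ-< z x<y))

  +-mono-< : ∀ {w x y z} → w < x → y < z → w + y < x + z
  +-mono-< w<x y<z = <-trans (+-monoˡ-< _ w<x) (+-monoʳ-< _ y<z)

  x+y-y≈x : ∀ x y → x + y - y ≈ x
  x+y-y≈x x y = trans (+-assoc x y (- y)) (trans (+-congˡ (-‿inverseʳ y)) (+-identityʳ x))

  x≈z+y⇒x-y≈z : ∀ {x y z} → x ≈ z + y → x - y ≈ z
  x≈z+y⇒x-y≈z {x} {y} {z} eq = trans (+-congʳ eq) (x+y-y≈x z y)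

  x-y+y≈x : ∀ x y → x - y + y ≈ x
  x-y+y≈x x y = trans (+-assoc x (- y) y) (trans (+-congˡ (-‿inverseˡ y)) (+-identityʳ x))

  telescope : ∀ x y z → (y - x) + (z - y) ≈ z - x
  telescope x y z = sym (x≈z+y⇒x-y≈z (begin
    z                                ≈⟨ x-y+y≈x z y ⟨
    z - y + y                        ≈⟨ +-congˡ (x-y+y≈x y x) ⟨
    z - y + (y - x + x)              ≈⟨ solve 3 (λ a b c → a :+ (b :+ c) := (b :+ a) :+ c) refl _ _ _ ⟩
    (y - x) + (z - y) + x            ∎))

  x<y⇒0<y-x : ∀ {x y} → x < y → 0# < y - x
  x<y⇒0<y-x {x} x<y = <-respˡ-≈ (-‿inverseʳ x) (+-monoˡ-< (- x) x<y)

  1≉0 : ¬ 1# ≈ 0#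
  1≉0 1≈0 = <-irrefl (sym 1≈0) 0<1

  1+1≉0 : ¬ 1# + 1# ≈ 0#
  1+1≉0 2≈0 = <-irrefl (trans (+-identityʳ 0#) (sym 2≈0)) (+-mono-< 0<1 0<1)

  x*y≈0⇒x≈0 : ∀ {x y} → ¬ y ≈ 0# → x * y ≈ 0# → x ≈ 0#
  x*y≈0⇒x≈0 {x} {y} y≉0 xy≈0 with y⁻¹ , yy⁻¹≈1 ← inverse y y≉0 = begin
    x              ≈⟨ *-identityʳ x ⟨
    x * 1#         ≈⟨ *-congˡ yy⁻¹≈1 ⟨
    x * (y * y⁻¹)  ≈⟨ *-assoc x y y⁻¹ ⟨
    x * y * y⁻¹    ≈⟨ *-congʳ xy≈0 ⟩
    0# * y⁻¹       ≈⟨ zeroˡ y⁻¹ ⟩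
    0#             ∎

  -- Applied to the finitely many class levels and to their negatives, this bounds all differences
  -- of levels at once.
  upperBound : ∀ {m} (f : Fin m → Carrier) → ∃[ b ] (∀ i → f i < b)
  upperBound {zero}  f = 0# , λ ()
  upperBound {suc m} f with upperBound (f ∘ suc)
  ... | b , f<b with compare (f zero) b
  ...   | tri< f₀<b _ _ = b , λ { zero → f₀<b ; (suc i) → f<b i }
  ...   | tri≈ _ f₀≈b _ = b + 1# , λ { zero → <-respˡ-≈ (sym f₀≈b) b<b+1 ; (suc i) → <-trans (f<b i) b<b+1 }
    where
    b<b+1 : b < b + 1#
    b<b+1 = <-respˡ-≈ (+-identityʳ b) (+-monoʳ-< b 0<1)
  ...   | tri> _ _ b<f₀ = f zero + 1# , λ { zero → f₀<f₀+1 ; (suc i) → <-trans (f<b i) (<-trans b<f₀ f₀<f₀+1) }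
    where
    f₀<f₀+1 : f zero < f zero + 1#
    f₀<f₀+1 = <-respˡ-≈ (+-identityʳ (f zero)) (+-monoʳ-< (f zero) 0<1)

-- Linear functionals, relations and solvability of linear systems.

module LinearAlgebra {c ℓ₁ ℓ₂} (K : OrderedField c ℓ₁ ℓ₂) where
  open OrderedField K hiding (zero)
  open OrderedFieldProperties K
  open RingProperties ring using (-‿distribˡ-*)
  open SemiringSum semiring
    using (sum-cong-≋; sum-replicate-zero; ∑-distrib-+; ∑-comm; *-distribˡ-sum; *-distribʳ-sum)
  open SemiringSolver commutativeSemiring using (solve; _:+_; _:*_; _:=_)
  open SetoidReasoning setoid

  dot : ∀ {d} → Vector Carrier d → Vector Carrier d → Carrier
  dot u v = sum (λ x → u x * v x)

  dot-congʳ : ∀ {d} (u : Vector Carrier d) {v w} → (∀ x → v x ≈ w x) → dot u v ≈ dot u w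
  dot-congʳ u v≈w = sum-cong-≋ (*-congˡ ∘ v≈w)

  dot-comm : ∀ {d} (u v : Vector Carrier d) → dot u v ≈ dot v u
  dot-comm u v = sum-cong-≋ (λ x → *-comm (u x) (v x))

  sum-zero : ∀ {d} {f : Vector Carrier d} → (∀ x → f x ≈ 0#) → sum f ≈ 0#
  sum-zero {d} f≈0 = trans (sum-cong-≋ f≈0) (sum-replicate-zero d)

  dot-zeroʳ : ∀ {d} (u : Vector Carrier d) {v} → (∀ x → v x ≈ 0#) → dot u v ≈ 0#
  dot-zeroʳ u v≈0 = sum-zero (λ x → trans (*-congˡ (v≈0 x)) (zeroʳ (u x)))

  dot-+ : ∀ {d} (u v w : Vector Carrier d) → dot u (λ x → v x + w x) ≈ dot u v + dot u w
  dot-+ u v w = trans (sum-cong-≋ (λ x → distribˡ (u x) (v x) (w x)))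
                      (∑-distrib-+ (λ x → u x * v x) (λ x → u x * w x))

  dot-* : ∀ {d} (u : Vector Carrier d) s v → dot u (λ x → s * v x) ≈ s * dot u v
  dot-* u s v = trans
    (sum-cong-≋ (λ x → solve 3 (λ a b c → a :* (b :* c) := b :* (a :* c)) refl (u x) s (v x)))
    (sym (*-distribˡ-sum s (λ x → u x * v x)))

  dot-linear : ∀ {d} (u v : Vector Carrier d) s w →
               dot u (λ x → v x + s * w x) ≈ dot u v + s * dot u w
  dot-linear u v s w = trans (dot-+ u v (λ x → s * w x)) (+-congˡ (dot-* u s w))

  dot-dot : ∀ {m d} (a : Vector Carrier m) (b : Vector Carrier d) (v : Fin m → Vector Carrier d) →
            dot a (λ l → dot b (v l)) ≈ dot b (λ x → dot a (λ l → v l x))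
  dot-dot a b v = begin
    sum (λ l → a l * dot b (v l))
      ≈⟨ sum-cong-≋ (λ l → *-distribˡ-sum (a l) (λ x → b x * v l x)) ⟩
    sum (λ l → sum (λ x → a l * (b x * v l x)))
      ≈⟨ ∑-comm (λ l x → a l * (b x * v l x)) ⟩
    sum (λ x → sum (λ l → a l * (b x * v l x)))
      ≈⟨ sum-cong-≋ (λ x → dot-* a (b x) (λ l → v l x)) ⟩
    sum (λ x → b x * dot a (λ l → v l x)) ∎

  -- By exchanging the two sums, coefficients that annihilate every coordinate annihilate every
  -- combination of the coordinates. Below, the coordinates are either those of Cayley points or the
  -- generators of a span, evaluated at fixed entries.
  relation-dot : ∀ {m d} (a : Vector Carrier m) (b : Vector Carrier d) (v : Fin m → Vector Carrier d) →
                 (∀ x → dot a (λ l → v l x) ≈ 0#) → dot a (λ l → dot b (v l)) ≈ 0#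
  relation-dot a b v rel = trans (dot-dot a b v) (dot-zeroʳ b rel)

  sum-++ : ∀ m {d} (f : Vector Carrier (m ℕ.+ d)) →
           sum f ≈ sum (λ i → f (i ↑ˡ d)) + sum (λ k → f (m ↑ʳ k))
  sum-++ zero    f = sym (+-identityˡ _)
  sum-++ (suc m) f = trans (+-congˡ (sum-++ m (f ∘ suc))) (sym (+-assoc _ _ _))

  fromℤ-1 : fromℤ 1ℤ ≈ 1#
  fromℤ-1 = +-identityʳ 1#

  dot-unit : ∀ {d} (u : Vector Carrier d) i → dot u (fromℤ ∘ unit i) ≈ u i
  dot-unit u zero = begin
    u zero * fromℤ 1ℤ + sum (λ x → u (suc x) * 0#)
      ≈⟨ +-cong (*-congˡ fromℤ-1) (dot-zeroʳ (u ∘ suc) (λ _ → refl)) ⟩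
    u zero * 1# + 0#  ≈⟨ +-identityʳ _ ⟩
    u zero * 1#       ≈⟨ *-identityʳ _ ⟩
    u zero            ∎
  dot-unit u (suc i) = begin
    u zero * 0# + dot (u ∘ suc) (fromℤ ∘ unit i)  ≈⟨ +-cong (zeroʳ _) (dot-unit (u ∘ suc) i) ⟩
    0# + u (suc i)                                ≈⟨ +-identityˡ _ ⟩
    u (suc i)                                     ∎

  -- The coordinates of unit vectors are 0 or 1, so four cases suffice instead of additivity of
  -- `fromℤ` in general.
  fromℤ-⊕ : ∀ {d} (i j x : Fin d) →
            fromℤ ((unit i ⊕ unit j) x) ≈ fromℤ (unit i x) + fromℤ (unit j x)
  fromℤ-⊕ i j x with does (i Fin.≟ x) | does (j Fin.≟ x)
  ... | true  | true  = +-congʳ (sym fromℤ-1)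
  ... | true  | false = sym (+-identityʳ _)
  ... | false | true  = sym (+-identityˡ _)
  ... | false | false = sym (+-identityˡ _)

  LinearlyIndependent : ∀ {m d} → (Fin m → Vector Carrier d) → Set _
  LinearlyIndependent {m} v =
    (a : Vector Carrier m) → (∀ x → dot a (λ l → v l x) ≈ 0#) → ∀ l → a l ≈ 0#

  -- If the first vector vanished, coefficient 1 on it and 0 elsewhere would be a nontrivial
  -- relation. Equality with zero is decidable by trichotomy, so the pivot can be searched for.
  nonzeroCoordinate : ∀ {m d} (v : Fin (suc m) → Vector Carrier d) → LinearlyIndependent v →
                      ∃[ p ] ¬ v zero p ≈ 0#
  nonzeroCoordinate v indep with Fin.any? (λ p → ¬? (v zero p ≈? 0#))
  ... | yes found = found
  ... | no ¬found = contradiction (indep (1# Vec.∷ λ _ → 0#) relation zero) 1≉0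
    where
    relation : ∀ x → dot (1# Vec.∷ λ _ → 0#) (λ l → v l x) ≈ 0#
    relation x = begin
      1# * v zero x + sum (λ l → 0# * v (suc l) x)
        ≈⟨ +-cong (*-identityˡ _) (sum-zero (λ l → zeroˡ (v (suc l) x))) ⟩
      v zero x + 0#  ≈⟨ +-identityʳ _ ⟩
      v zero x       ≈⟨ decidable-stable (v zero x ≈? 0#) (λ v≉0 → ¬found (x , v≉0)) ⟩
      0#             ∎

  -- Gaussian elimination, with a pivot p in the first row.
  solveIndependent : ∀ {m d} (v : Fin m → Vector Carrier d) → LinearlyIndependent v →
                     (y : Vector Carrier m) → ∃[ b ] (∀ l → dot b (v l) ≈ y l)
  solveIndependent {zero}  v indep y = (λ _ → 0#) , λ ()
  solveIndependent {suc m} v indep y = b , solved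
    where
    p       = proj₁ (nonzeroCoordinate v indep)
    v₀      = v zero
    q       = proj₁ (inverse (v₀ p) (proj₂ (nonzeroCoordinate v indep)))
    v₀p*q≈1 = proj₂ (inverse (v₀ p) (proj₂ (nonzeroCoordinate v indep)))

    ρ : Vector Carrier m
    ρ l = v (suc l) p * q

    v′ : Fin m → Vector Carrier _
    v′ l x = v (suc l) x + - ρ l * v₀ x

    indep′ : LinearlyIndependent v′
    -- A relation among the reduced rows is one among the original rows, in which the coefficient of
    -- the first row collects the multiples of it that were subtracted.
    indep′ a relation l = indep (dot a (λ l → - ρ l) Vec.∷ a) (λ x → trans (expand x) (relation x)) (suc l)
      where
      expand : ∀ x → dot (dot a (λ l → - ρ l) Vec.∷ a) (λ l → v l x) ≈ dot a (λ l → v′ l x)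
      expand x = begin
        dot a (λ l → - ρ l) * v₀ x + dot a (λ l → v (suc l) x)  ≈⟨ +-comm _ _ ⟩
        dot a (λ l → v (suc l) x) + dot a (λ l → - ρ l) * v₀ x
          ≈⟨ +-congˡ (*-distribʳ-sum (v₀ x) (λ l → a l * - ρ l)) ⟩
        dot a (λ l → v (suc l) x) + sum (λ l → a l * - ρ l * v₀ x)
          ≈⟨ +-congˡ (sum-cong-≋ (λ l → *-assoc (a l) (- ρ l) (v₀ x))) ⟩
        dot a (λ l → v (suc l) x) + dot a (λ l → - ρ l * v₀ x)
          ≈⟨ dot-+ a (λ l → v (suc l) x) (λ l → - ρ l * v₀ x) ⟨
        dot a (λ l → v′ l x) ∎

    b′-solved = solveIndependent v′ indep′ (λ l → y (suc l) + - ρ l * y zero)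
    b′ = proj₁ b′-solved

    -- The reduced rows vanish at `p`, so adding `t` times the unit vector at `p` to `b′` keeps
    -- their equations; `t` is chosen to satisfy the equation of the first row.
    t : Carrier
    t = q * (y zero - dot b′ v₀)

    b : Vector Carrier _
    b x = b′ x + t * fromℤ (unit p x)

    dot-b : ∀ u → dot b u ≈ dot b′ u + t * u p
    dot-b u = begin
      dot b u                                ≈⟨ dot-comm b u ⟩
      dot u b                                ≈⟨ dot-linear u b′ t (fromℤ ∘ unit p) ⟩
      dot u b′ + t * dot u (fromℤ ∘ unit p)  ≈⟨ +-cong (dot-comm u b′) (*-congˡ (dot-unit u p)) ⟩
      dot b′ u + t * u p                     ∎

    b-v₀ : dot b v₀ ≈ y zero
    b-v₀ = begin
      dot b v₀                                        ≈⟨ dot-b v₀ ⟩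
      dot b′ v₀ + q * (y zero - dot b′ v₀) * v₀ p
        ≈⟨ +-congˡ (solve 3 (λ a b c → a :* b :* c := (c :* a) :* b) refl q _ (v₀ p)) ⟩
      dot b′ v₀ + v₀ p * q * (y zero - dot b′ v₀)     ≈⟨ +-congˡ (*-congʳ v₀p*q≈1) ⟩
      dot b′ v₀ + 1# * (y zero - dot b′ v₀)           ≈⟨ +-congˡ (*-identityˡ _) ⟩
      dot b′ v₀ + (y zero - dot b′ v₀)                ≈⟨ +-comm _ _ ⟩
      y zero - dot b′ v₀ + dot b′ v₀                  ≈⟨ x-y+y≈x _ _ ⟩
      y zero                                          ∎

    v′-p : ∀ l → v′ l p ≈ 0#
    v′-p l = begin
      v (suc l) p + - ρ l * v₀ p        ≈⟨ +-congˡ (-‿distribˡ-* (ρ l) (v₀ p)) ⟨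
      v (suc l) p - v (suc l) p * q * v₀ p
        ≈⟨ +-congˡ (-‿cong (solve 3 (λ a b c → a :* b :* c := a :* (c :* b)) refl _ q (v₀ p))) ⟩
      v (suc l) p - v (suc l) p * (v₀ p * q)  ≈⟨ +-congˡ (-‿cong (*-congˡ v₀p*q≈1)) ⟩
      v (suc l) p - v (suc l) p * 1#     ≈⟨ +-congˡ (-‿cong (*-identityʳ _)) ⟩
      v (suc l) p - v (suc l) p          ≈⟨ -‿inverseʳ _ ⟩
      0#                                 ∎

    restore : ∀ x s z → x + - s * z + s * z ≈ x
    restore x s z = trans (+-congʳ (+-congˡ (sym (-‿distribˡ-* s z)))) (x-y+y≈x x (s * z))

    solved : ∀ l → dot b (v l) ≈ y l
    solved zero    = b-v₀
    solved (suc l) = begin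
      dot b (v (suc l))                          ≈⟨ dot-congʳ b (λ x → restore (v (suc l) x) (ρ l) (v₀ x)) ⟨
      dot b (λ x → v′ l x + ρ l * v₀ x)          ≈⟨ dot-linear b (v′ l) (ρ l) v₀ ⟩
      dot b (v′ l) + ρ l * dot b v₀              ≈⟨ +-cong (dot-b (v′ l)) (*-congˡ b-v₀) ⟩
      dot b′ (v′ l) + t * v′ l p + ρ l * y zero
        ≈⟨ +-congʳ (+-cong (proj₂ b′-solved l) (trans (*-congˡ (v′-p l)) (zeroʳ t))) ⟩
      y (suc l) + - ρ l * y zero + 0# + ρ l * y zero  ≈⟨ +-congʳ (+-identityʳ _) ⟩
      y (suc l) + - ρ l * y zero + ρ l * y zero  ≈⟨ restore (y (suc l)) (ρ l) (y zero) ⟩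
      y (suc l)                                  ∎

-- Lists without repetition, and walks in a graph.

Unique-++⁻ˡ : {A : Set} (xs : List A) {ys : List A} → Unique (xs ++ ys) → Unique xs
Unique-++⁻ˡ []       _        = []
Unique-++⁻ˡ (x ∷ xs) (x∉ ∷ u) = ++⁻ˡ xs x∉ ∷ Unique-++⁻ˡ xs u

Unique-++⇒∉ : {A : Set} (xs : List A) {ys : List A} → Unique (xs ++ ys) → ∀ {y} → y ∈ ys → y ∉ xs
Unique-++⇒∉ (x ∷ xs) (x∉ ∷ _) y∈ys (here ≡.refl) = All.lookup x∉ (∈-++⁺ʳ xs y∈ys) ≡.refl
Unique-++⇒∉ (x ∷ xs) (_ ∷ u)  y∈ys (there y∈)  = Unique-++⇒∉ xs u y∈ys y∈

Unique-∷ʳ : {A : Set} {xs : List A} {y : A} → Unique xs → y ∉ xs → Unique (xs ++ [ y ])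
Unique-∷ʳ u y∉xs = Unique.++⁺ u (All.[] ∷ []) λ { (y∈xs , here ≡.refl) → y∉xs y∈xs }

module GraphProperties {V : Set} (Adj : Rel V 0ℓ) where
  open ≡ using (refl; sym; trans)
  open Graph Adj

  start∈ : ∀ {u v} (w : Walk u v) → u ∈ vertices w
  start∈ ε       = here refl
  start∈ (_ ◅ _) = here refl

  end∈ : ∀ {u v} (w : Walk u v) → v ∈ vertices w
  end∈ ε       = here refl
  end∈ (_ ◅ w) = there (end∈ w)

  -- The edge between the two walks is kept explicit: without it, the junction vertex would occur in
  -- both lists.
  vertices-◅◅ : ∀ {u v x y} (p : Walk u v) (e : Adj v x) (q : Walk x y) →
                vertices (p ◅◅ e ◅ q) ≡ vertices p ++ vertices q
  vertices-◅◅ ε       e q = refl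
  vertices-◅◅ (_ ◅ p) e q = cong (_ ∷_) (vertices-◅◅ p e q)

  -- An initial segment of a path is a path; this provides the hypothesis of `depth-step` at each
  -- edge of a longer path.
  Unique-start : ∀ {u v x y} (p : Walk u v) (e : Adj v x) (q : Walk x y) →
                 Unique (vertices (p ◅◅ e ◅ q)) → Unique (vertices p ++ [ x ])
  Unique-start p e ε       uniq = subst Unique (vertices-◅◅ p e ε) uniq
  Unique-start {x = x} p e q@(_ ◅ r) uniq = Unique-++⁻ˡ (vertices p ++ [ x ])
    (subst Unique (trans (vertices-◅◅ p e q) (sym (++-assoc (vertices p) [ x ] (vertices r)))) uniq)

  split : ∀ {u v x} (p : Walk u v) → x ∈ vertices p →
          Σ[ q ∈ Walk u x ] Σ[ r ∈ Walk x v ] p ≡ q ◅◅ r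
  split ε       (here refl) = ε , ε , refl
  split (e ◅ p) (here refl) = ε , e ◅ p , refl
  split (e ◅ p) (there x∈p) with q , r , refl ← split p x∈p = e ◅ q , r , refl

  vertices-gmap : (f : V → V) (g : ∀ {x y} → Adj x y → Adj (f x) (f y)) →
                  ∀ {u v} (w : Walk u v) → vertices (gmap f g w) ≡ map f (vertices w)
  vertices-gmap f g ε       = refl
  vertices-gmap f g (_ ◅ w) = cong (_ ∷_) (vertices-gmap f g w)

-- The involution on paths, and depth below a root.

module SymbicTypeProperties {n : ℕ} (𝒯 : SymbicType n) where
  open ≡ using (refl; sym; trans)
  open SymbicType 𝒯
  open GraphProperties Adj

  σ-involutive : ∀ x → σ (σ x) ≡ x
  σ-involutive (leaf unprimed i) = refl
  σ-involutive (leaf primed i)   = refl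
  σ-involutive (node v)          = cong node (τ-involutive v)

  σ-injective : ∀ {x y} → σ x ≡ σ y → x ≡ y
  σ-injective {x} {y} σx≡σy = trans (sym (σ-involutive x)) (trans (cong σ σx≡σy) (σ-involutive y))

  σ-path : ∀ {u v} → Path u v → Path (σ u) (σ v)
  σ-path (w , uniq) = gmap σ σ-adj w ,
    subst Unique (sym (vertices-gmap σ σ-adj w)) (Unique.map⁺ σ-injective uniq)

  -- The image of a path under the injective graph map `σ` is again a path, so uniqueness of paths
  -- identifies it with the chosen one.
  pathVertices-σ : ∀ u v → pathVertices (path (σ u) (σ v)) ≡ map σ (pathVertices (path u v))
  pathVertices-σ u v = trans (path-unique (path (σ u) (σ v)) (σ-path (path u v))) (vertices-gmap σ σ-adj (proj₁ (path u v)))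

  node≟ : ∀ v (x : V) → Dec (node {n} v ≡ x)
  node≟ v (leaf a i) = no λ ()
  node≟ v (node u)   = map′ (cong node) (λ { refl → refl }) (v Fin.≟ u)

  leaf-neighbour-unique : ∀ {a i x y} → Adj (leaf a i) x → Adj (leaf a i) y → x ≡ y
  leaf-neighbour-unique {a} {i} {x} {y} lx ly with leaf-degree a i
  ... | z ∷ [] , _ , refl , nbr with Equivalence.from (nbr x) lx | Equivalence.from (nbr y) ly
  ...   | here refl | here refl = refl

  module Rooted (O : Node) where

    -- Counts vertices rather than edges, so `O` itself has depth 1; the offset cancels wherever
    -- depths are compared.
    depth : V → ℕ
    depth v = length (pathVertices (path (node O) v))

    depth-path : ∀ {v} (π : Path (node O) v) → length (pathVertices π) ≡ depth v
    depth-path {v} π = cong length (path-unique π (path (node O) v))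

    depth-step : ∀ {x y} (p : Walk (node O) x) (e : Adj x y) → Unique (vertices p ++ [ y ]) →
                 depth y ≡ suc (depth x)
    depth-step {x} {y} p e uniq = begin
      depth y                      ≡⟨ depth-path (p ◅◅ e ◅ ε , subst Unique (sym p,y) uniq) ⟨
      length (vertices (p ◅◅ e ◅ ε)) ≡⟨ cong length p,y ⟩
      length (vertices p ++ [ y ]) ≡⟨ length-++ (vertices p) ⟩
      length (vertices p) ℕ.+ 1    ≡⟨ ℕ.+-comm _ 1 ⟩
      suc (length (vertices p))    ≡⟨ cong suc (depth-path (p , Unique-++⁻ˡ (vertices p) uniq)) ⟩
      suc (depth x)                ∎
      where
      open ≡.≡-Reasoning
      p,y = vertices-◅◅ p e ε

    -- Either `v` is not on the path from `O` to `x`, and the edge extends that path to `v`; or it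
    -- is, and cutting the path at `v` and following the edge back to `x` is again a path to `x`.
    depth-adj : ∀ {x v} → Adj x (node v) →
                depth (node v) ≡ suc (depth x) ⊎ depth x ≡ suc (depth (node v))
    depth-adj {x} {v} e = adj (path (node O) x)
      where
      adj : Path (node O) x → depth (node v) ≡ suc (depth x) ⊎ depth x ≡ suc (depth (node v))
      adj (p , uniq) with Any.any? (node≟ v) (vertices p)
      ... | no  v∉p = inj₁ (depth-step p e (Unique-∷ʳ uniq v∉p))
      ... | yes v∈p with split {x = node v} p v∈p
      ...   | q , ε     , _    = contradiction e (adj-irrefl refl)
      ...   | q , a ◅ r , refl = inj₂ (depth-step q (adj-sym e)
        (Unique-∷ʳ (Unique-++⁻ˡ (vertices q) uniq′) (Unique-++⇒∉ (vertices q) uniq′ (end∈ r))))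
        where
        uniq′ : Unique (vertices q ++ vertices r)
        uniq′ = subst Unique (vertices-◅◅ q a r) uniq

    -- The involution fixes `O`, so it carries the path from `O` to `v` to the path from `O` to
    -- `τ v` without changing the number of vertices.
    depth-τ : τ O ≡ O → ∀ v → depth (node (τ v)) ≡ depth (node v)
    depth-τ τO≡O v = begin
      depth (node (τ v))
        ≡⟨ cong (λ o → length (pathVertices (path (node o) (node (τ v))))) τO≡O ⟨
      length (pathVertices (path (σ (node O)) (σ (node v))))
        ≡⟨ cong length (pathVertices-σ (node O) (node v)) ⟩
      length (map σ (pathVertices (path (node O) (node v))))
        ≡⟨ length-map σ (pathVertices (path (node O) (node v))) ⟩
      depth (node v) ∎
      where open ≡.≡-Reasoning

-- Distances under the involution, and metrics with prescribed distances from the root.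

module MetricProperties {c ℓ₁ ℓ₂} (K : OrderedField c ℓ₁ ℓ₂) {n : ℕ} (𝒯 : SymbicType n) where
  open ≡ using (refl; sym; trans)
  open SymbicType 𝒯
  open GraphProperties Adj
  open SymbicTypeProperties 𝒯
  private module K = OrderedField K
  open K using (Carrier; _≈_; _<_; _+_; _-_; 0#)
  open OrderedFieldProperties K using (telescope; x<y⇒0<y-x)

  module _ (μ : Metric K 𝒯) where
    open Metric μ

    pathLength-◅ : ∀ {x y z} (w : Walk y z) →
                   pathLength (x ∷ vertices w) ≡ edgeLength x y + pathLength (vertices w)
    pathLength-◅ ε       = refl
    pathLength-◅ (_ ◅ _) = refl

    edgeLength-σ : ∀ {x y} → Adj x y → edgeLength (σ x) (σ y) ≈ edgeLength x y
    edgeLength-σ {leaf _ _} {leaf _ _} _ = K.refl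
    edgeLength-σ {leaf _ _} {node _}   _ = K.refl
    edgeLength-σ {node _}   {leaf _ _} _ = K.refl
    edgeLength-σ {node _}   {node _}   e = len-τ e

    pathLength-σ : ∀ {x y} (w : Walk x y) → pathLength (map σ (vertices w)) ≈ pathLength (vertices w)
    pathLength-σ ε             = K.refl
    pathLength-σ (e ◅ ε)       = K.+-congʳ (edgeLength-σ e)
    pathLength-σ (e ◅ w@(_ ◅ _)) = K.+-cong (edgeLength-σ e) (pathLength-σ w)

    dist-τ : ∀ u v → dist (τ u) (τ v) ≈ dist u v
    dist-τ u v = K.trans (K.reflexive (cong pathLength (pathVertices-σ (node u) (node v))))
                         (pathLength-σ (proj₁ (path (node u) (node v))))

    dist-refl : ∀ u → dist u u ≡ 0#
    dist-refl u = cong pathLength (path-unique (path (node u) (node u)) (ε , All.[] ∷ []))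

  -- Away from O the depth rises by exactly one along each edge, so increments
  -- of f along the edges are positive and add up to differences of f.
  module Potential (O : Node) (τO≡O : τ O ≡ O) (f : Node → Carrier)
    (f-τ : ∀ v → f (τ v) ≈ f v)
    (f-< : ∀ {u w} → Rooted.depth O (node w) ≡ suc (Rooted.depth O (node u)) → f u < f w)
    where
    open Rooted O

    -- On an edge this is the absolute value of the difference of `f`, since `f` is larger at the
    -- deeper end.
    len : Node → Node → Carrier
    len u w = if does (depth (node u) ℕ.<? depth (node w)) then f w - f u else f u - f w

    len-up : ∀ {u w} → depth (node w) ≡ suc (depth (node u)) → len u w ≡ f w - f u
    len-up {u} {w} eq = cong (if_then f w - f u else f u - f w)
      (dec-true (depth (node u) ℕ.<? depth (node w)) (subst (depth (node u) ℕ.<_) (sym eq) (ℕ.n<1+n _)))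

    len-down : ∀ {u w} → depth (node u) ≡ suc (depth (node w)) → len u w ≡ f u - f w
    len-down {u} {w} eq = cong (if_then f w - f u else f u - f w)
      (dec-false (depth (node u) ℕ.<? depth (node w))
        (ℕ.<-asym (subst (depth (node w) ℕ.<_) (sym eq) (ℕ.n<1+n _))))

    -- The involution preserves which end of an edge is deeper, so `len` takes the same branch on an
    -- edge and on its image.
    depth-step-τ : ∀ {u w} → depth (node w) ≡ suc (depth (node u)) →
                   depth (node (τ w)) ≡ suc (depth (node (τ u)))
    depth-step-τ {u} {w} eq = trans (depth-τ τO≡O w) (trans eq (cong suc (sym (depth-τ τO≡O u))))

    metric : Metric K 𝒯
    metric = record { len = len ; len-sym = len-sym ; len-pos = len-pos ; len-τ = len-τ }
      where
      len-sym : ∀ {u w} → Adj (node u) (node w) → len u w ≈ len w u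
      len-sym e with depth-adj e
      ... | inj₁ eq = K.reflexive (trans (len-up eq) (sym (len-down eq)))
      ... | inj₂ eq = K.reflexive (trans (len-down eq) (sym (len-up eq)))

      len-pos : ∀ {u w} → Adj (node u) (node w) → 0# < len u w
      len-pos e with depth-adj e
      ... | inj₁ eq = subst (0# <_) (sym (len-up eq)) (x<y⇒0<y-x (f-< eq))
      ... | inj₂ eq = subst (0# <_) (sym (len-down eq)) (x<y⇒0<y-x (f-< eq))

      f-τ-diff : ∀ u w → f (τ w) - f (τ u) ≈ f w - f u
      f-τ-diff u w = K.+-cong (f-τ w) (K.-‿cong (f-τ u))

      len-τ : ∀ {u w} → Adj (node u) (node w) → len (τ u) (τ w) ≈ len u w
      len-τ {u} {w} e with depth-adj e
      ... | inj₁ eq = subst₂ _≈_ (sym (len-up (depth-step-τ eq))) (sym (len-up eq)) (f-τ-diff u w)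
      ... | inj₂ eq = subst₂ _≈_ (sym (len-down (depth-step-τ eq))) (sym (len-down eq)) (f-τ-diff w u)

    open Metric metric using (pathLength; dist)

    -- An inner vertex of a path is a node since leaves have degree 1.
    pathLength-potential : ∀ {x v} (p : Walk (node O) (node x)) (w : Walk (node x) (node v)) →
                           Unique (vertices (p ◅◅ w)) → pathLength (vertices w) ≈ f v - f x
    pathLength-potential p ε uniq = K.sym (K.-‿inverseʳ _)
    pathLength-potential p (_◅_ {j = leaf a i} e (e′ ◅ w)) uniq
      with refl ← leaf-neighbour-unique e′ (adj-sym e) =
      contradiction (end∈ p) (Unique-++⇒∉ (vertices p)
        (subst Unique (vertices-◅◅ p e (e′ ◅ w)) uniq) (there (start∈ w)))
    pathLength-potential {x} {v} p (_◅_ {j = node y} e w) uniq = begin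
      pathLength (node x ∷ vertices w)   ≡⟨ pathLength-◅ metric w ⟩
      len x y + pathLength (vertices w)
        -- The walk `p` from `O` is carried along so that `p` followed by `e` begins a path from
        -- `O`; this makes `y` one deeper than `x`.
        ≈⟨ K.+-cong (K.reflexive (len-up (depth-step p e (Unique-start p e w uniq))))
                    (pathLength-potential (p ◅◅ e ◅ ε) w uniq′) ⟩
      (f y - f x) + (f v - f y)          ≈⟨ telescope (f x) (f y) (f v) ⟩
      f v - f x                          ∎
      where
      open SetoidReasoning K.setoid
      uniq′ : Unique (vertices ((p ◅◅ e ◅ ε) ◅◅ w))
      uniq′ = subst (Unique ∘ vertices) (sym (◅◅-assoc p (e ◅ ε) w)) uniq

    dist-potential : ∀ v → dist O v ≈ f v - f O
    dist-potential v = pathLength-potential ε (proj₁ π) (proj₂ π)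
      where π = path (node O) (node v)

-- Enumeration of a subset of the ground set.

Unique⇒lookup-injective : {A : Set} {xs : List A} → Unique xs → Injective _≡_ _≡_ (List.lookup xs)
Unique⇒lookup-injective (x∉ ∷ u) {zero}  {zero}  _  = ≡.refl
Unique⇒lookup-injective (x∉ ∷ u) {zero}  {suc m} eq = contradiction eq (All.lookup x∉ (∈-lookup m))
Unique⇒lookup-injective (x∉ ∷ u) {suc l} {zero}  eq = contradiction (≡.sym eq) (All.lookup x∉ (∈-lookup l))
Unique⇒lookup-injective (x∉ ∷ u) {suc l} {suc m} eq = cong suc (Unique⇒lookup-injective u eq)

module GroundSet {n : ℕ} (S : Subset (E n)) where

  entry : ↥ S → Fin n × Fin n
  entry = proj₁ ∘ proj₁

  -- The proofs of `i ≤ j` and of membership in `S` are irrelevant, so the pair of indices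
  -- determines the element.
  entry-injective : ∀ {s t} → entry s ≡ entry t → s ≡ t
  entry-injective {(_ , i≤j) , s} {(_ , i≤j′) , s′} ≡.refl
    with ≡.refl ← Fin.≤-irrelevant i≤j i≤j′ with ≡.refl ← T-irrelevant s s′ = ≡.refl

  _≟ᵉ_ : DecidableEquality (Fin n × Fin n)
  _≟ᵉ_ = ≡-dec Fin._≟_ Fin._≟_

  InS : Fin n × Fin n → Set
  InS (i , j) = Σ[ i≤j ∈ i Fin.≤ j ] T (S ((i , j) , i≤j))

  InS? : ∀ e → Dec (InS e)
  InS? (i , j) with i Fin.≤? j
  ... | no  i≰j = no (i≰j ∘ proj₁)
  ... | yes i≤j with T? (S ((i , j) , i≤j))
  ...   | yes s = yes (i≤j , s)
  ...   | no ¬s = no λ (i≤j′ , s) → ¬s (subst (λ p → T (S ((i , j) , p))) (Fin.≤-irrelevant i≤j′ i≤j) s)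

  -- Listing `S` without repetition turns it into a family indexed by `Fin`, as affine independence
  -- and the elimination require.
  entries : List (Fin n × Fin n)
  entries = filter InS? (cartesianProduct (allFin n) (allFin n))

  entries-unique : Unique entries
  entries-unique = Unique.filter⁺ InS? (Unique.cartesianProduct⁺ (Unique.allFin⁺ n) (Unique.allFin⁺ n))

  enumerate : Fin (length entries) → ↥ S
  enumerate l = (List.lookup entries l , proj₁ inS) , proj₂ inS
    where inS = proj₂ (∈-filter⁻ InS? {xs = cartesianProduct (allFin n) (allFin n)} (∈-lookup {xs = entries} l))

  enumerate-injective : Injective _≡_ _≡_ enumerate
  enumerate-injective eq = Unique⇒lookup-injective entries-unique (cong entry eq)

  enumerate-surjective : ∀ s → ∃[ l ] enumerate l ≡ s
  enumerate-surjective s@((e , i≤j) , inS) = Any.index e∈ , entry-injective (≡.sym (lookup-index e∈))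
    where
    e∈ : e ∈ entries
    e∈ = ∈-filter⁺ InS? (∈-cartesianProduct⁺ (∈-allFin (proj₁ e)) (∈-allFin (proj₂ e))) (i≤j , inS)

-- Weights on the Cayley points, and matrices in the span of the cone.

module Cayley {c ℓ₁ ℓ₂} (K : OrderedField c ℓ₁ ℓ₂) {n : ℕ} (T : SymbicTree K n)
  (O : SymbicTree.Node T) (τO≡O : SymbicTree.τ T O ≡ O) (N : Numbering (SymbicTree.type T) O)
  where
  private
    𝒯 : SymbicType n
    𝒯 = SymbicTree.type T
  open OrderedField K hiding (zero)
  open OrderedFieldProperties K
  open LinearAlgebra K
  open SymbicType 𝒯
  open SymbicTypeProperties 𝒯
  open Rooted O
  open MetricProperties K 𝒯
  open Numbering N renaming (surjective to class-surjective)
  open RingProperties ring using (-1*x≈-x)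
  open MonoidMult +-monoid renaming (_×_ to _×ℕ_) using ()
  open SemiringSolver commutativeSemiring using (solve; con; _:+_; _:=_)
  open SemiringSum semiring using (*-distribʳ-sum)
  open SetoidReasoning setoid

  classOf : Fin n × Fin n → Fin (suc r)
  classOf (i , j) = class (divergence O i j)

  point : E n → Vector Carrier (n ℕ.+ r)
  point e = fromℤ ∘ cayleyPoint 𝒯 O N e

  -- The apex of O is the origin, so the level of its class is 0.
  level : Vector Carrier (n ℕ.+ r) → Fin (suc r) → Carrier
  level w zero    = 0#
  level w (suc k) = w (n ↑ʳ k)

  translation : Vector Carrier (n ℕ.+ r) → Vector Carrier n
  translation w i = w (i ↑ˡ r)

  dot-apex : ∀ w k → sum (λ x → w (n ↑ʳ x) * fromℤ (apex (nodeConfiguration 𝒯 O N) k x)) ≈ level w k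
  dot-apex w zero    = dot-zeroʳ (λ x → w (n ↑ʳ x)) (λ _ → refl)
  dot-apex w (suc k) = dot-unit (λ x → w (n ↑ʳ x)) k

  -- The functional is evaluated blockwise: the first `n` coordinates give the two translation
  -- terms, and the apex selects a single level.
  dot-point : ∀ w (e : E n) → let (i , j) = proj₁ e in
              dot w (point e) ≈ level w (classOf (i , j)) + (translation w i + translation w j)
  dot-point w ((i , j) , i≤j) = begin
    dot w (point ((i , j) , i≤j))  ≈⟨ sum-++ n (λ x → w x * point ((i , j) , i≤j) x) ⟩
    dot X (λ x → fromℤ ((u Vec.++ a) (x ↑ˡ r))) + dot Y (λ x → fromℤ ((u Vec.++ a) (n ↑ʳ x)))
      ≈⟨ +-cong (dot-congʳ X (λ x → reflexive (cong fromℤ (lookup-++ˡ u a x))))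
                (dot-congʳ Y (λ x → reflexive (cong fromℤ (lookup-++ʳ u a x)))) ⟩
    dot X (fromℤ ∘ u) + dot Y (fromℤ ∘ a)
      ≈⟨ +-cong (dot-congʳ X (fromℤ-⊕ i j)) (dot-apex w (classOf (i , j))) ⟩
    dot X (λ x → fromℤ (unit i x) + fromℤ (unit j x)) + level w (classOf (i , j))
      ≈⟨ +-congʳ (dot-+ X (fromℤ ∘ unit i) (fromℤ ∘ unit j)) ⟩
    dot X (fromℤ ∘ unit i) + dot X (fromℤ ∘ unit j) + level w (classOf (i , j))
      ≈⟨ +-congʳ (+-cong (dot-unit X i) (dot-unit X j)) ⟩
    X i + X j + level w (classOf (i , j))  ≈⟨ +-comm _ _ ⟩
    level w (classOf (i , j)) + (X i + X j) ∎
    where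
    X = translation w
    a = apex (nodeConfiguration 𝒯 O N) (classOf (i , j))
    Y = λ x → w (n ↑ʳ x)
    u = unit i ⊕ unit j

  -- Equally numbered nodes agree up to `τ`, and `τ` preserves distances and fixes `O`.
  dist-class : ∀ (μ : Metric K 𝒯) {u v} → class u ≡ class v → Metric.dist μ O u ≈ Metric.dist μ O v
  dist-class μ {u} {v} eq with Equivalence.to (class-≡ u v) eq
  ... | inj₁ u≡v  = reflexive (cong (Metric.dist μ O) u≡v)
  ... | inj₂ u≡τv = begin
    Metric.dist μ O u          ≡⟨ ≡.cong₂ (Metric.dist μ) (≡.sym τO≡O) u≡τv ⟩
    Metric.dist μ (τ O) (τ v)  ≈⟨ dist-τ μ O v ⟩
    Metric.dist μ O v          ∎

  -- The weights are the translation `X` together with the distances from `O` to representatives of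
  -- the remaining classes.
  cone⇒dot : ∀ {M} → Cone K 𝒯 O M → ∃[ w ] (∀ (e : E n) → M (proj₁ e) ≈ dot w (point e))
  cone⇒dot {M} (μ , X , M≈) = w , λ e@((i , j) , _) → begin
    M (i , j)                                          ≈⟨ M≈ i j ⟩
    Metric.dist μ O (divergence O i j) + (X i + X j)
      ≈⟨ +-cong (level-w (divergence O i j)) (+-cong (translation-w i) (translation-w j)) ⟨
    level w (classOf (i , j)) + (translation w i + translation w j)  ≈⟨ dot-point w e ⟨
    dot w (point e)                                    ∎
    where
    d : Fin (suc r) → Carrier
    d k = Metric.dist μ O (proj₁ (class-surjective k))

    w : Vector Carrier (n ℕ.+ r)
    w = X Vec.++ (d ∘ suc)

    translation-w : ∀ i → translation w i ≈ X i
    translation-w i = reflexive (lookup-++ˡ X (d ∘ suc) i)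

    level≈d : ∀ k → level w k ≈ d k
    -- The representative of class 0 comes from surjectivity and need not be `O` by definition;
    -- `dist-class` compares the two.
    level≈d zero    = begin
      0#                 ≡⟨ dist-refl μ O ⟨
      Metric.dist μ O O  ≈⟨ dist-class μ (≡.trans class-O (≡.sym (proj₂ (class-surjective zero)))) ⟩
      d zero             ∎
    level≈d (suc k) = reflexive (lookup-++ʳ X (d ∘ suc) k)

    level-w : ∀ v → level w (class v) ≈ Metric.dist μ O v
    level-w v = trans (level≈d (class v)) (dist-class μ (proj₂ (class-surjective (class v))))

  -- For t exceeding all differences of D, both D + t·depth and t·depth are
  -- distances from O for suitable metrics, and D is their difference.
  span-levels : ∀ (D : Fin (suc r) → Carrier) → D zero ≈ 0# → (X : Vector Carrier n) →
                Span K (Cone K 𝒯 O) (λ (i , j) → D (classOf (i , j)) + (X i + X j))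
  span-levels D D₀≈0 X = 2 , coefficient , generator , inCone , combination
    where
    D⁺ D⁻ t : Carrier
    D⁺ = proj₁ (upperBound D)
    D⁻ = proj₁ (upperBound (λ k → - D k))
    -- Each `D k` is below `D⁺` and each `- D l` below `D⁻`, hence every `D k - D l` is below `t`.
    -- Taking `k` equal to `l` shows that `t` is positive.
    t  = D⁺ + D⁻

    D-D<t : ∀ k l → D k - D l < t
    D-D<t k l = +-mono-< (proj₂ (upperBound D) k) (proj₂ (upperBound (λ k → - D k)) l)

    0<t : 0# < t
    0<t = <-respˡ-≈ (-‿inverseʳ (D zero)) (D-D<t zero zero)

    height : Node → Carrier
    height v = depth (node v) ×ℕ t

    height-suc : ∀ {u w} → depth (node w) ≡ suc (depth (node u)) → height w ≈ t + height u
    height-suc eq = reflexive (cong (_×ℕ t) eq)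

    height-τ : ∀ v → height (τ v) ≈ height v
    height-τ v = reflexive (cong (_×ℕ t) (depth-τ τO≡O v))

    f : Node → Carrier
    f v = D (class v) + height v

    f-τ : ∀ v → f (τ v) ≈ f v
    f-τ v = +-cong (reflexive (cong D (Equivalence.from (class-≡ (τ v) v) (inj₂ ≡.refl)))) (height-τ v)

    -- One step away from `O` raises the height by `t`, which outweighs any drop of `D` between the
    -- two classes.
    f-< : ∀ {u w} → depth (node w) ≡ suc (depth (node u)) → f u < f w
    f-< {u} {w} eq = <-respˡ-≈ below (<-respʳ-≈ above
      (+-monoˡ-< (D (class w) + height u) (D-D<t (class u) (class w))))
      where
      below : D (class u) - D (class w) + (D (class w) + height u) ≈ f u
      below = trans (sym (+-assoc _ _ _)) (+-congʳ (x-y+y≈x _ _))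
      above : t + (D (class w) + height u) ≈ f w
      above = trans (solve 3 (λ a b c → a :+ (b :+ c) := b :+ (a :+ c)) refl t (D (class w)) (height u))
                    (+-congˡ (sym (height-suc {u} {w} eq)))

    height-< : ∀ {u w} → depth (node w) ≡ suc (depth (node u)) → height u < height w
    height-< {u} {w} eq = <-respˡ-≈ (+-identityˡ _)
      (<-respʳ-≈ (sym (height-suc {u} {w} eq)) (+-monoˡ-< (height u) 0<t))

    module F = Potential O τO≡O f f-τ f-<
    module H = Potential O τO≡O height height-τ (λ {u} {w} → height-< {u} {w})

    coefficient : Vector Carrier 2
    coefficient zero    = 1#
    coefficient (suc _) = - 1#

    generator : Vector (Matrix K n) 2
    generator zero    (i , j) = distanceMatrix K 𝒯 O F.metric (i , j) + (X i + X j)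
    generator (suc _) (i , j) = distanceMatrix K 𝒯 O H.metric (i , j) + (0# + 0#)

    inCone : ∀ l → Cone K 𝒯 O (generator l)
    inCone zero    = F.metric , X , λ i j → refl
    inCone (suc _) = H.metric , (λ _ → 0#) , λ i j → refl

    dist-difference : ∀ v → Metric.dist F.metric O v ≈ D (class v) + Metric.dist H.metric O v
    dist-difference v = begin
      Metric.dist F.metric O v       ≈⟨ F.dist-potential v ⟩
      D (class v) + height v - f O
        -- As `D` vanishes on the class of `O`, both potentials have the same value at `O`, so
        -- normalising them to distances subtracts the same constant.
        ≈⟨ +-congˡ (-‿cong (trans (+-congʳ (trans (reflexive (cong D class-O)) D₀≈0)) (+-identityˡ _))) ⟩
      D (class v) + height v - height O    ≈⟨ +-assoc _ _ _ ⟩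
      D (class v) + (height v - height O)  ≈⟨ +-congˡ (H.dist-potential v) ⟨
      D (class v) + Metric.dist H.metric O v ∎

    combination : ∀ e → D (classOf e) + (X (proj₁ e) + X (proj₂ e)) ≈ sum (λ l → coefficient l * generator l e)
    combination (i , j) = sym (begin
      1# * (dF + (X i + X j)) + (- 1# * (dH + (0# + 0#)) + 0#)
        ≈⟨ +-cong (*-identityˡ _) (trans (+-identityʳ _) (-1*x≈-x _)) ⟩
      dF + (X i + X j) - (dH + (0# + 0#))
        ≈⟨ x≈z+y⇒x-y≈z (begin
             dF + (X i + X j)                                     ≈⟨ +-congʳ (dist-difference v) ⟩
             D (class v) + dH + (X i + X j)
               ≈⟨ solve 3 (λ a b c → a :+ b :+ c := a :+ c :+ (b :+ (con 0 :+ con 0))) refl (D (class v)) dH (X i + X j) ⟩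
             D (class v) + (X i + X j) + (dH + (0# + 0#))          ∎) ⟩
      D (class v) + (X i + X j)                                    ∎)
      where
      v = divergence O i j
      dF = Metric.dist F.metric O v
      dH = Metric.dist H.metric O v

  -- The two implications between the notions of independence.

  module _ (S : Subset (E n)) where
    open GroundSet S

    row : ↥ S → Vector Carrier (n ℕ.+ r)
    row s = point (proj₁ s)

    CayleyIndependent : Set _
    CayleyIndependent = AffinelyIndependent K {I = ↥ S} (λ s → cayleyPoint 𝒯 O N (proj₁ s))

    -- A relation among the points annihilates every matrix of the cone, hence every matrix of the
    -- span. Some matrix of the span restricts on `S` to the indicator of the element at `l₀`, and
    -- evaluating the relation on it isolates the coefficient `a l₀`.
    independent⇒cayleyIndependent : Independent K T O S → CayleyIndependent
    independent⇒cayleyIndependent indep k s s-inj a _ relation l₀ = begin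
      a l₀                                ≈⟨ dot-unit a l₀ ⟨
      dot a (fromℤ ∘ unit l₀)             ≈⟨ dot-congʳ a (λ l → trans (M≈y (s l)) (reflexive (y∘s l))) ⟨
      dot a (λ l → M (entry (s l)))       ≈⟨ dot-congʳ a (λ l → M≈ (entry (s l))) ⟩
      dot a (λ l → dot b (λ g → G g (entry (s l))))
        ≈⟨ relation-dot a b (λ l g → G g (entry (s l))) generator-relation ⟩
      0#                                  ∎
      where
      y : ↥ S → Carrier
      -- Since `s` is injective, this indicator pulled back along `s` is the unit vector at `l₀`.
      y e = fromℤ (if does (entry (s l₀) ≟ᵉ entry e) then 1ℤ else 0ℤ)

      y∘s : ∀ l → y (s l) ≡ fromℤ (unit l₀ l)
      y∘s l with l₀ Fin.≟ l
      ... | yes ≡.refl = cong (λ q → fromℤ (if q then _ else _)) (dec-true (entry (s l₀) ≟ᵉ entry (s l)) ≡.refl)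
      ... | no  l₀≢l   = cong (λ q → fromℤ (if q then _ else _))
        (dec-false (entry (s l₀) ≟ᵉ entry (s l)) (l₀≢l ∘ s-inj ∘ entry-injective))

      M    = proj₁ (indep y)
      span = proj₁ (proj₂ (indep y))
      M≈y  = proj₂ (proj₂ (indep y))
      b    = proj₁ (proj₂ span)
      G    = proj₁ (proj₂ (proj₂ span))
      G∈C  = proj₁ (proj₂ (proj₂ (proj₂ span)))
      M≈   = proj₂ (proj₂ (proj₂ (proj₂ span)))

      generator-relation : ∀ g → dot a (λ l → G g (entry (s l))) ≈ 0#
      generator-relation g = trans
        (dot-congʳ a (λ l → proj₂ (cone⇒dot (G∈C g)) (proj₁ (s l))))
        (relation-dot a (proj₁ (cone⇒dot (G∈C g))) (row ∘ s) relation)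

    -- The functional `ones` takes the value `1# + 1#` at every point, so a linear relation
    -- multiplies its coefficient sum by 2 to zero; 2 is nonzero in an ordered field.
    cayleyIndependent⇒linearlyIndependent :
      CayleyIndependent → LinearlyIndependent (row ∘ enumerate)
    cayleyIndependent⇒linearlyIndependent indep a relation =
      indep _ enumerate enumerate-injective a sum-a≈0 relation
      where
      ones : Vector Carrier (n ℕ.+ r)
      ones = (λ (_ : Fin n) → 1#) Vec.++ (λ (_ : Fin r) → 0#)

      level-ones : ∀ k → level ones k ≈ 0#
      level-ones zero    = refl
      level-ones (suc k) = reflexive (lookup-++ʳ (λ (_ : Fin n) → 1#) (λ _ → 0#) k)

      translation-ones : ∀ i → translation ones i ≈ 1#
      translation-ones i = reflexive (lookup-++ˡ (λ _ → 1#) (λ (_ : Fin r) → 0#) i)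

      dot-ones : ∀ e → dot ones (point e) ≈ 1# + 1#
      dot-ones e@((i , j) , _) = trans (dot-point ones e) (trans
        (+-cong (level-ones (classOf (i , j))) (+-cong (translation-ones i) (translation-ones j)))
        (+-identityˡ (1# + 1#)))

      sum-a≈0 : sum a ≈ 0#
      sum-a≈0 = x*y≈0⇒x≈0 1+1≉0 (begin
        sum a * (1# + 1#)                          ≈⟨ *-distribʳ-sum (1# + 1#) a ⟩
        sum (λ l → a l * (1# + 1#))                ≈⟨ dot-congʳ a (λ l → dot-ones (proj₁ (enumerate l))) ⟨
        dot a (λ l → dot ones (row (enumerate l)))  ≈⟨ relation-dot a ones (row ∘ enumerate) relation ⟩
        0#                                         ∎)

    dot⇒span : ∀ (w : Vector Carrier (n ℕ.+ r)) (y : ↥ S → Carrier) → (∀ e → dot w (row e) ≈ y e) →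
               ∃[ M ] Span K (Cone K 𝒯 O) M × (∀ (e : ↥ S) → M (entry e) ≈ y e)
    dot⇒span w y w·row≈y = _ , span-levels (level w) refl (translation w) ,
      λ e → trans (sym (dot-point w (proj₁ e))) (w·row≈y e)

    cayleyIndependent⇒independent : CayleyIndependent → Independent K T O S
    cayleyIndependent⇒independent indep y = dot⇒span w y λ e →
      -- The system was solved along the enumeration, which reaches every element of `S`.
      let l , enumerate-l≡e = enumerate-surjective e in
      subst (λ e → dot w (row e) ≈ y e) enumerate-l≡e (proj₂ solution l)
      where
      solution = solveIndependent (row ∘ enumerate) (cayleyIndependent⇒linearlyIndependent indep) (y ∘ enumerate)
      w = proj₁ solution

proposition6p6 : ∀ {c ℓ₁ ℓ₂} (K : OrderedField c ℓ₁ ℓ₂) (n : ℕ) (T : SymbicTree K n)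
    (O : SymbicTree.Node T) → SymbicTree.τ T O ≡ O →
    (N : Numbering (SymbicTree.type T) O) (S : Subset (E n)) →
    Independent K T O S
    ⇔ AffinelyIndependent K {I = ↥ S} (λ s → cayleyPoint (SymbicTree.type T) O N (proj₁ s))
proposition6p6 K n T O τO≡O N S = mk⇔ (independent⇒cayleyIndependent S) (cayleyIndependent⇒independent S)
  where open Cayley K T O τO≡O N
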